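{- Assume the following conjecture: (*) for every $m\ge 1$, every constellation in $\mathcal{G}(p_m)$ whose gaps sum to less than $2p_{m+1}$ and which has fewer than $p_{m+1}-1$ gaps occurs infinitely often as a constellation among primes. Let $g_n=p_{n+1}-p_n$. Then: (1) (Spikes) $\limsup_{n\to\infty} g_n/g_{n+1}=\infty$ and $\liminf_{n\to\infty} g_n/g_{n+1}=0$. (2) (Oscillation) There is no $n_0$ such that for all $k\ge 1$, $g_{n_0+2k-1}<g_{n_0+2k}$ and $g_{n_0+2k}>g_{n_0+2k+1}$. (3) (Superlinearity) For every $k\ge 1$ there are infinitely many $j$ with $g_j<g_{j+1}<\cdots<g_{j+k}$.
   Context: $p_i$ denotes the $i$-th prime ($p_1=2$), $\Pi_m=\prod_{i=1}^m p_i$, and $\Phi_m=\prod_{i=1}^m(p_i-1)$. The cycle of gaps $\mathcal{G}(p_m)=(g_{m,1},\ldots,g_{m,\Phi_m})$ is the sequence of differences between consecutive integers in $[1,\Pi_m+1]$ that are coprime to $\Pi_m$, in increasing order starting from $1$; it is regarded as a cycle, with indices extended periodically by $g_{m,i+\Phi_m}=g_{m,i}$. A constellation is a finite sequence $s=(a_1,\ldots,a_j)$ of positive integers (gaps); it is a constellation in $\mathcal{G}(p_m)$ if for some index $i$, $g_{m,i+l-1}=a_l$ for $l=1,\ldots,j$. It occurs infinitely often as a constellation among primes if for infinitely many $i$ the consecutive primes $p_i,p_{i+1},\ldots,p_{i+j}$ satisfy $p_{i+l}-p_{i+l-1}=a_l$ for $l=1,\ldots,j$. -}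

module Defs where

open import Data.Empty using (⊥-elim)
open import Data.Fin.Base using (Fin; toℕ)
import Data.Integer.Base as ℤ
open import Data.List.Base as List using (List; []; _∷_; length; filter; applyUpTo)
open import Data.List.Relation.Unary.All as ListAll using ()
open import Data.Nat.Base
open import Data.Nat.Coprimality as Coprimality using (Coprime; coprime?)
open import Data.Nat.Divisibility
open import Data.Nat.DivMod using (_mod_)
open import Data.Nat.Primality
open import Data.Nat.Primality.Factorisation using (factorise; PrimeFactorisation)
open import Data.Nat.Properties
open import Data.Nat.ListAction using (product)
open import Data.Product using (∃; ∃-syntax; _×_; _,_; proj₁; proj₂)
open import Data.Rational.Base as ℚ using (ℚ; 0ℚ)
open import Data.Sum using (_⊎_; inj₁; inj₂)
open import Data.Vec.Base as Vec using (Vec)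
open import Data.Vec.Relation.Unary.All using (All)
open import Data.Unit using (tt)
open import Function.Base using (_∘_)
open import Level using (0ℓ)
open import Relation.Binary.PropositionalEquality
open import Relation.Nullary using (¬_; Dec; yes; no; contradiction; _×-dec_)
open import Relation.Unary using (Pred; Decidable)

-- The bound is strict so that the witnesses are always ≥ 1: sequences
-- below are indexed from 1, and their value at 0 is junk.  This is the
-- positive form of the classically equivalent Data.Nat.InfinitelyOften.Inf.

InfinitelyOften : ∀ {ℓ} → Pred ℕ ℓ → Set ℓ
InfinitelyOften P = ∀ N → ∃[ n ] N < n × P n

Limsup≡∞ : (ℕ → ℚ) → Set
Limsup≡∞ a = ∀ K → InfinitelyOften λ n → K ℚ.< a n

Liminf≡ : (ℕ → ℚ) → ℚ → Set
Liminf≡ a L = ∀ ε → 0ℚ ℚ.< ε →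
    (∃[ N ] ∀ n → N < n → L ℚ.- ε ℚ.< a n)
  × InfinitelyOften λ n → a n ℚ.< L ℚ.+ ε

Least : Pred ℕ 0ℓ → Set
Least P = ∃[ n ] P n × (∀ {k} → k < n → ¬ P k)

least : ∀ {P} → Decidable P → ∃ P → Least P
least {P} P? (w , Pw) with search (suc w)
  where
  search : ∀ v → Least P ⊎ (∀ {k} → k < v → ¬ P k)
  search zero = inj₂ λ ()
  search (suc v) with search v
  ... | inj₁ found = inj₁ found
  ... | inj₂ none with P? v
  ...   | yes Pv = inj₁ (v , Pv , none)
  ...   | no ¬Pv = inj₂ λ {k} k<1+v Pk → none (≤∧≢⇒< (s≤s⁻¹ k<1+v) λ { refl → ¬Pv Pk }) Pk
... | inj₁ found = found
... | inj₂ none = contradiction Pw (none (n<1+n w))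

private
  primeFactor : ∀ n → 1 < n → ∃[ q ] Prime q × q ∣ n
  primeFactor n@(suc _) 1<n = go factors factorsPrime isFactorisation
    where
    open PrimeFactorisation (factorise n)
    go : ∀ qs → ListAll.All Prime qs → n ≡ product qs → ∃[ q ] Prime q × q ∣ n
    go []       _                   n≡1 = contradiction (sym n≡1) (<⇒≢ 1<n)
    go (q ∷ qs) (pr ListAll.∷ _) n≡  = q , pr , subst (q ∣_) (sym n≡) (m∣m*n (product qs))

  m≤n⇒m∣n! : ∀ {m n} .{{_ : NonZero m}} → m ≤ n → m ∣ n !
  m≤n⇒m∣n! {suc m} m≤n = ∣-trans (m∣m*n (m !)) (m≤n⇒m!∣n! m≤n)

  primeAbove : ∀ n → ∃[ q ] n < q × Prime q
  primeAbove n with primeFactor (suc (n !)) (s≤s (1≤n! n))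
  ... | q , pr , q∣1+n! = q , ≰⇒> q≰n , pr
    where
    q≰n : ¬ q ≤ n
    q≰n q≤n = ¬prime[1] (subst Prime (∣1⇒≡1 q∣1) pr)
      where
      q∣1 : q ∣ 1
      q∣1 = ∣m+n∣m⇒∣n (subst (q ∣_) (+-comm 1 (n !)) q∣1+n!)
                      (m≤n⇒m∣n! {{prime⇒nonZero pr}} q≤n)

leastPrimeAbove : ∀ n → Least λ q → n < q × Prime q
leastPrimeAbove n = least (λ q → (n <? q) ×-dec prime? q) (primeAbove n)

-- p i is the i-th prime for i ≥ 1; p 0 = 1 is junk.

p : ℕ → ℕ
p zero    = 1
p (suc i) = proj₁ (leastPrimeAbove (p i))

p-<suc : ∀ i → p i < p (suc i)
p-<suc i = proj₁ (proj₁ (proj₂ (leastPrimeAbove (p i))))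

p-prime : ∀ i → Prime (p (suc i))
p-prime i = proj₂ (proj₁ (proj₂ (leastPrimeAbove (p i))))

p-least : ∀ i {q} → Prime q → p i < q → p (suc i) ≤ q
p-least i pr pi<q = ≮⇒≥ λ q<p → proj₂ (proj₂ (leastPrimeAbove (p i))) q<p (pi<q , pr)

g : ℕ → ℕ
g n = p (suc n) ∸ p n

g-nonZero : ∀ n → NonZero (g n)
g-nonZero n = >-nonZero (m<n⇒0<n∸m (p-<suc n))

gapRatio : ℕ → ℚ
gapRatio n = (ℤ.+ g n) ℚ./ g (suc n)
  where instance _ = g-nonZero (suc n)

Π : ℕ → ℕ
Π zero    = 1
Π (suc m) = Π m * p (suc m)

Φ : ℕ → ℕ
Φ zero    = 1
Φ (suc m) = Φ m * (p (suc m) ∸ 1)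

-- applyUpTo suc (suc N) lists 1, …, N + 1.

coprimes : ℕ → List ℕ
coprimes N = filter (λ k → coprime? k N) (applyUpTo suc (suc N))

differences : List ℕ → List ℕ
differences []           = []
differences (_ ∷ [])     = []
differences (x ∷ y ∷ zs) = (y ∸ x) ∷ differences (y ∷ zs)

-- length-gaps below: φ(N q) = φ(N) (q - 1) for a prime q not dividing
-- N, by counting the integers in [1, N q] coprime to N and discarding
-- the multiples of q among them.

private
  S : (ℕ → ℕ) → ℕ → ℕ
  S f zero    = 0
  S f (suc n) = f 0 + S (f ∘ suc) n

  S-cong : ∀ {f f′} n → (∀ k → f k ≡ f′ k) → S f n ≡ S f′ n
  S-cong zero    eq = refl
  S-cong (suc n) eq = cong₂ _+_ (eq 0) (S-cong n (eq ∘ suc))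

  S-split : ∀ f m n → S f (m + n) ≡ S f m + S (λ k → f (m + k)) n
  S-split f zero    n = refl
  S-split f (suc m) n = trans (cong (λ t → f 0 + t) (S-split (f ∘ suc) m n))
                              (sym (+-assoc (f 0) (S (f ∘ suc) m) _))

  S-add : ∀ f f′ n → S (λ k → f k + f′ k) n ≡ S f n + S f′ n
  S-add f f′ zero    = refl
  S-add f f′ (suc n) = begin
    (f 0 + f′ 0) + S (λ k → f (suc k) + f′ (suc k)) n ≡⟨ cong ((f 0 + f′ 0) +_) (S-add _ _ n) ⟩
    (f 0 + f′ 0) + (s + s′)                           ≡⟨ +-assoc (f 0) (f′ 0) (s + s′) ⟩
    f 0 + (f′ 0 + (s + s′))                           ≡⟨ cong (f 0 +_) (x∙yz≈y∙xz (f′ 0) s s′) ⟩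
    f 0 + (s + (f′ 0 + s′))                           ≡⟨ +-assoc (f 0) s _ ⟨
    (f 0 + s) + (f′ 0 + s′)                           ∎
    where
    open ≡-Reasoning
    open import Algebra.Properties.CommutativeSemigroup +-commutativeSemigroup using (x∙yz≈y∙xz)
    s  = S (f ∘ suc) n
    s′ = S (f′ ∘ suc) n

  S-blocks : ∀ f n b → S f (b * n) ≡ S (λ j → S (λ r → f (j * n + r)) n) b
  S-blocks f n zero    = refl
  S-blocks f n (suc b) = trans (S-split f n (b * n)) (cong (S f n +_)
    (trans (S-blocks (λ k → f (n + k)) n b)
           (S-cong b λ j → S-cong n λ r → cong f (sym (+-assoc n (j * n) r)))))

  S-const : ∀ c n → S (λ _ → c) n ≡ n * c
  S-const c zero    = refl
  S-const c (suc n) = cong (c +_) (S-const c n)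

  S-last : ∀ f n → (∀ {k} → k < n → f k ≡ 0) → S f (suc n) ≡ f n
  S-last f zero    _    = +-identityʳ (f 0)
  S-last f (suc n) zero′ = trans (cong (_+ S (f ∘ suc) (suc n)) (zero′ z<s))
                                (S-last (f ∘ suc) n (zero′ ∘ s<s))

  ⟦_⟧ : ∀ {A : Set} → Dec A → ℕ
  ⟦ yes _ ⟧ = 1
  ⟦ no  _ ⟧ = 0

  ⟦⟧-cong : ∀ {A B : Set} (a : Dec A) (b : Dec B) → (A → B) → (B → A) → ⟦ a ⟧ ≡ ⟦ b ⟧
  ⟦⟧-cong (yes _) (yes _)  _ _ = refl
  ⟦⟧-cong (yes a) (no ¬b)  f _ = contradiction (f a) ¬b
  ⟦⟧-cong (no ¬a) (yes b)  _ f = contradiction (f b) ¬a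
  ⟦⟧-cong (no _)  (no _)   _ _ = refl

  length-filter-applyUpTo : ∀ {P : Pred ℕ 0ℓ} (P? : Decidable P) f n →
    length (filter P? (applyUpTo f n)) ≡ S (λ k → ⟦ P? (f k) ⟧) n
  length-filter-applyUpTo P? f zero = refl
  length-filter-applyUpTo P? f (suc n) with P? (f 0)
  ... | yes _ = cong suc (length-filter-applyUpTo P? (f ∘ suc) n)
  ... | no  _ = length-filter-applyUpTo P? (f ∘ suc) n

  φ : ℕ → ℕ
  φ N = S (λ k → ⟦ coprime? (suc k) N ⟧) N

  coprime-*ʳ : ∀ {k m n} → Coprime k m → Coprime k n → Coprime k (m * n)
  coprime-*ʳ k⊥m k⊥n (d∣k , d∣mn) =
    k⊥n (d∣k , Coprimality.coprime-divisor (λ (e∣d , e∣m) → k⊥m (∣-trans e∣d d∣k , e∣m)) d∣mn)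

  prime∤⇒coprime : ∀ {q k} → Prime q → ¬ q ∣ k → Coprime k q
  prime∤⇒coprime pr q∤k (d∣k , d∣q) with prime⇒irreducible pr d∣q
  ... | inj₁ d≡1  = d≡1
  ... | inj₂ refl = contradiction d∣k q∤k

  module _ (N q : ℕ) (pr : Prime q) (q∤N : ¬ q ∣ N) where

    multiple : ℕ → ℕ
    multiple k = ⟦ (q ∣? k) ×-dec coprime? k N ⟧

    split : ∀ k → ⟦ coprime? k N ⟧ ≡ ⟦ coprime? k (N * q) ⟧ + multiple k
    split k = go (coprime? k N) (coprime? k (N * q)) (q ∣? k)
      where
      go : (a : Dec (Coprime k N)) (b : Dec (Coprime k (N * q))) (c : Dec (q ∣ k)) →
           ⟦ a ⟧ ≡ ⟦ b ⟧ + ⟦ c ×-dec a ⟧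
      go (yes _)   (yes k⊥Nq) (yes q∣k) =
        contradiction (subst Prime (k⊥Nq (q∣k , n∣m*n N)) pr) ¬prime[1]
      go (yes _)   (yes _)    (no _)    = refl
      go (yes _)   (no _)     (yes _)   = refl
      go (yes k⊥N) (no ¬k⊥Nq) (no q∤k)  =
        ⊥-elim (¬k⊥Nq (coprime-*ʳ {k} {N} k⊥N (prime∤⇒coprime pr q∤k)))
      go (no ¬k⊥N) (yes k⊥Nq) _         =
        ⊥-elim (¬k⊥N λ (d∣k , d∣N) → k⊥Nq (d∣k , ∣m⇒∣m*n q d∣N))
      go (no _)    (no _)     (yes _)   = refl
      go (no _)    (no _)     (no _)    = refl

    all-count : S (λ k → ⟦ coprime? (suc k) N ⟧) (q * N) ≡ q * φ N
    all-count = trans (S-blocks _ N q) (trans (S-cong q λ j → S-cong N λ r → periodic j r)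
                                              (S-const (φ N) q))
      where
      periodic : ∀ j r → ⟦ coprime? (suc (j * N + r)) N ⟧ ≡ ⟦ coprime? (suc r) N ⟧
      periodic j r = ⟦⟧-cong (coprime? (suc (j * N + r)) N) (coprime? (suc r) N)
        (λ c {d} (d∣r , d∣N) → c {d}
           (subst (d ∣_) (+-suc (j * N) r) (∣m∣n⇒∣m+n (∣n⇒∣m*n j d∣N) d∣r) , d∣N))
        (λ c {d} (d∣jN+r , d∣N) → c {d}
           (∣m+n∣m⇒∣n (subst (d ∣_) (sym (+-suc (j * N) r)) d∣jN+r) (∣n⇒∣m*n j d∣N) , d∣N))

    multiple-count : S (λ k → multiple (suc k)) (N * q) ≡ φ N
    multiple-count = trans (S-blocks _ q N) (S-cong N λ j → block j q refl)
      where
      block : ∀ j t → t ≡ q → S (λ r → multiple (suc (j * q + r))) t ≡ ⟦ coprime? (suc j) N ⟧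
      block j zero    0≡q = contradiction (subst Prime (sym 0≡q) pr) ¬prime[0]
      block j (suc t) t≡q = trans (S-last _ t small) (⟦⟧-cong
          ((q ∣? k) ×-dec coprime? k N) (coprime? (suc j) N)
          (λ (_ , c) {d} (d∣1+j , d∣N) → c {d} (subst (d ∣_) (sym k≡) (∣m⇒∣m*n q d∣1+j) , d∣N))
          (λ c → subst (q ∣_) (sym k≡) (n∣m*n (suc j)) ,
             λ {d} → subst (λ x → Coprime x N) (sym k≡)
               (Coprimality.sym (coprime-*ʳ {N} {suc j} (Coprimality.sym c)
                 (prime∤⇒coprime pr q∤N))) {d}))
        where
        k = suc (j * q + t)
        k≡ : k ≡ suc j * q
        k≡ = trans (sym (+-suc (j * q) t)) (trans (cong (j * q +_) t≡q) (+-comm (j * q) q))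
        small : ∀ {r} → r < t → multiple (suc (j * q + r)) ≡ 0
        small {r} r<t with (q ∣? suc (j * q + r)) ×-dec coprime? (suc (j * q + r)) N
        ... | no  _       = refl
        ... | yes (q∣ , _) = contradiction
          (∣⇒≤ (∣m+n∣m⇒∣n (subst (q ∣_) (sym (+-suc (j * q) r)) q∣) (n∣m*n j)))
          (<⇒≱ (subst (suc r <_) t≡q (s<s r<t)))

    φ-*-prime : φ (N * q) ≡ φ N * (q ∸ 1)
    φ-*-prime = begin
      φ (N * q)                   ≡⟨ m+n∸n≡m (φ (N * q)) (φ N) ⟨
      (φ (N * q) + φ N) ∸ φ N     ≡⟨ cong (_∸ φ N) total ⟨
      q * φ N ∸ φ N               ≡⟨ cong (q * φ N ∸_) (*-identityˡ (φ N)) ⟨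
      q * φ N ∸ 1 * φ N           ≡⟨ *-distribʳ-∸ (φ N) q 1 ⟨
      (q ∸ 1) * φ N               ≡⟨ *-comm (q ∸ 1) (φ N) ⟩
      φ N * (q ∸ 1)               ∎
      where
      open ≡-Reasoning
      total : q * φ N ≡ φ (N * q) + φ N
      total = begin
        q * φ N                                      ≡⟨ all-count ⟨
        S (λ k → ⟦ coprime? (suc k) N ⟧) (q * N)     ≡⟨ cong (S _) (*-comm q N) ⟩
        S (λ k → ⟦ coprime? (suc k) N ⟧) (N * q)     ≡⟨ S-cong (N * q) (split ∘ suc) ⟩
        S (λ k → ⟦ coprime? (suc k) (N * q) ⟧ + multiple (suc k)) (N * q)
                                                     ≡⟨ S-add _ _ (N * q) ⟩
        φ (N * q) + S (multiple ∘ suc) (N * q)       ≡⟨ cong (φ (N * q) +_) multiple-count ⟩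
        φ (N * q) + φ N                              ∎

  prime>⇒∤Π : ∀ m {q} → Prime q → p m < q → ¬ q ∣ Π m
  prime>⇒∤Π zero    pr _    q∣1 = ¬prime[1] (subst Prime (∣1⇒≡1 q∣1) pr)
  prime>⇒∤Π (suc m) pr pm<q q∣Π with euclidsLemma (Π m) (p (suc m)) pr q∣Π
  ... | inj₁ q∣Πm = prime>⇒∤Π m pr (<-trans (p-<suc m) pm<q) q∣Πm
  ... | inj₂ q∣p  = <⇒≱ pm<q (∣⇒≤ {{prime⇒nonZero (p-prime m)}} q∣p)

  φΠ≡Φ : ∀ m → φ (Π m) ≡ Φ m
  φΠ≡Φ zero    = refl
  φΠ≡Φ (suc m) = trans
    (φ-*-prime (Π m) (p (suc m)) (p-prime m) (prime>⇒∤Π m (p-prime m) (p-<suc m)))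
    (cong (_* (p (suc m) ∸ 1)) (φΠ≡Φ m))

  length-coprimes : ∀ N → length (coprimes N) ≡ suc (φ N)
  length-coprimes N = begin
    length (coprimes N)                            ≡⟨ length-filter-applyUpTo {λ k → Coprime k N} (λ k → coprime? k N) suc (suc N) ⟩
    S f (suc N)                                    ≡⟨ cong (S f) (+-comm 1 N) ⟩
    S f (N + 1)                                    ≡⟨ S-split f N 1 ⟩
    φ N + (f (N + 0) + 0)                          ≡⟨ cong (φ N +_) (+-identityʳ _) ⟩
    φ N + f (N + 0)                                ≡⟨ cong (φ N +_) last ⟩
    φ N + 1                                        ≡⟨ +-comm (φ N) 1 ⟩
    suc (φ N)                                      ∎
    where
    open ≡-Reasoning
    f : ℕ → ℕ
    f k = ⟦ coprime? (suc k) N ⟧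
    last : f (N + 0) ≡ 1
    last = ⟦⟧-cong (coprime? (suc (N + 0)) N) (yes tt) _
      λ _ {d} (d∣1+N , d∣N) → ∣1⇒≡1 (∣m+n∣m⇒∣n
        (subst (d ∣_) (trans (cong suc (+-identityʳ N)) (+-comm 1 N)) d∣1+N) d∣N)

  length-differences : ∀ xs → length (differences xs) ≡ length xs ∸ 1
  length-differences []           = refl
  length-differences (_ ∷ [])     = refl
  length-differences (_ ∷ y ∷ zs) = cong suc (length-differences (y ∷ zs))

length-gaps : ∀ m → length (differences (coprimes (Π m))) ≡ Φ m
length-gaps m = trans (length-differences (coprimes (Π m)))
  (trans (cong (_∸ 1) (length-coprimes (Π m))) (φΠ≡Φ m))

Φ-nonZero : ∀ m → NonZero (Φ m)
Φ-nonZero zero    = _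
Φ-nonZero (suc m) = m*n≢0 (Φ m) (p (suc m) ∸ 1)
  where instance
    _ = Φ-nonZero m
    _ = >-nonZero (m<n⇒0<n∸m (nonTrivial⇒n>1 (p (suc m)) {{prime⇒nonTrivial (p-prime m)}}))

𝒢 : ∀ m → Vec ℕ (Φ m)
𝒢 m = Vec.cast (length-gaps m) (Vec.fromList (differences (coprimes (Π m))))

-- g_{m,i} with period Φ m; meant for i ≥ 1 only, since 0 ∸ 1 ≡ 0.

cyclicGap : ℕ → ℕ → ℕ
cyclicGap m i = Vec.lookup (𝒢 m) ((i ∸ 1) mod Φ m)
  where instance _ = Φ-nonZero m

OccursAt : ∀ {j} → Vec ℕ j → (ℕ → ℕ) → ℕ → Set
OccursAt {j} s a i = ∀ (l : Fin j) → a (i + toℕ l) ≡ Vec.lookup s l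

InCycle : ∀ {j} → Vec ℕ j → ℕ → Set
InCycle s m = ∃[ i ] 1 ≤ i × OccursAt s (cyclicGap m) i

InfinitelyOftenAmongPrimes : ∀ {j} → Vec ℕ j → Set
InfinitelyOftenAmongPrimes s = InfinitelyOften (OccursAt s g)

ConstellationConjecture : Set
ConstellationConjecture =
  ∀ m → 1 ≤ m →
  ∀ {j} (s : Vec ℕ j) → All (0 <_) s →
  InCycle s m →
  Vec.sum s < 2 * p (suc m) →
  j < p (suc m) ∸ 1 →
  InfinitelyOftenAmongPrimes s

{-# OPTIONS --safe #-}
module Submission where

-- Both spikes sit at the end of the cycle: around Π m the integers coprime to
-- Π m are Π m - p_{m+1}, Π m - 1, Π m + 1, Π m + p_{m+1}, so that (p_{m+1} - 1, 2)
-- and, cyclically, (2, p_{m+1} - 1) are constellations in 𝒢 m.  The increasing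
-- runs sit at its middle: with x = Π m / 2, which is odd, x + t (0 < t < p_{m+1})
-- is coprime to Π m exactly when t is a power of 2 other than 1, so that the gaps
-- after x + 2 are 2, 4, 8, ….  Sums and lengths are within the bounds of the
-- conjecture once m is large.  Three consecutive increasing gaps contradict
-- oscillation.

open import Defs
open import Data.Empty using (⊥)
open import Data.Fin.Base as Fin using (Fin; toℕ; fromℕ<)
open import Data.Fin.Properties using (toℕ-fromℕ<; toℕ<n; fromℕ<-cong)
import Data.Integer.Base as ℤ
import Data.Integer.Properties as ℤ
open import Data.List.Base using (List; []; _∷_; _++_; length; filter; applyUpTo)
open import Data.List.Properties using (filter-++; filter-none; filter-accept; length-++; ++-assoc)
open import Data.List.Relation.Unary.All as ListAll using ()
open import Data.Nat.Base
open import Data.Nat.Coprimality using (Coprime; coprime?; 1-coprimeTo)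
open import Data.Nat.Divisibility
open import Data.Nat.DivMod using (m%n<n; m<n⇒m%n≡m; [m+n]%n≡m%n)
open import Data.Nat.ListAction using (product)
open import Data.Nat.Primality
open import Data.Nat.Primality.Factorisation using (factorise; PrimeFactorisation)
open import Data.Nat.Properties
open import Data.Product using (∃-syntax; _×_; _,_; proj₁; proj₂)
open import Data.Rational.Base as ℚ using (mkℚ; 0ℚ)
import Data.Rational.Properties as ℚ
open import Data.Rational.Unnormalised.Base as ℚᵘ using (mkℚᵘ)
import Data.Rational.Unnormalised.Properties as ℚᵘ
open import Data.Sum using (_⊎_; inj₁; inj₂; [_,_]′)
open import Data.Vec.Base as Vec using (Vec)
open import Data.Vec.Properties using (lookup∘tabulate)
open import Data.Vec.Relation.Unary.All.Properties using (tabulate⁺)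
open import Function.Base using (_∘_)
open import Relation.Binary.PropositionalEquality
open import Relation.Nullary using (¬_; Dec; yes; no; contradiction)

-- Consecutive integers coprime to `N` and their positions.

Next : ℕ → ℕ → ℕ → Set
Next N a b = a < b × Coprime a N × Coprime b N × (∀ {c} → a < c → c < b → ¬ Coprime c N)

interval : ℕ → ℕ → List ℕ
interval u zero    = []
interval u (suc n) = suc u ∷ interval (suc u) n

applyUpTo≡interval : ∀ f u n → (∀ k → f k ≡ suc (u + k)) → applyUpTo f n ≡ interval u n
applyUpTo≡interval f u zero    eq = refl
applyUpTo≡interval f u (suc n) eq = cong₂ _∷_ (trans (eq 0) (cong suc (+-identityʳ u)))
  (applyUpTo≡interval (f ∘ suc) (suc u) n λ k → trans (eq (suc k)) (cong suc (+-suc u k)))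

interval-++ : ∀ u m n → interval u (m + n) ≡ interval u m ++ interval (u + m) n
interval-++ u zero    n = cong (λ v → interval v n) (sym (+-identityʳ u))
interval-++ u (suc m) n = cong (suc u ∷_) (trans (interval-++ (suc u) m n)
  (cong (λ v → interval (suc u) m ++ interval v n) (sym (+-suc u m))))

-- coprimesIn N u n and interval u n range over u + 1, …, u + n.

coprimesIn : ℕ → ℕ → ℕ → List ℕ
coprimesIn N u n = filter (λ k → coprime? k N) (interval u n)

coprimesIn-++ : ∀ N u m n → coprimesIn N u (m + n) ≡ coprimesIn N u m ++ coprimesIn N (u + m) n
coprimesIn-++ N u m n = trans (cong (filter (λ k → coprime? k N)) (interval-++ u m n))
  (filter-++ (λ k → coprime? k N) (interval u m) _)

coprimesIn-∷ : ∀ N u n → Coprime (suc u) N → coprimesIn N u (suc n) ≡ suc u ∷ coprimesIn N (suc u) n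
coprimesIn-∷ N u n c = filter-accept (λ k → coprime? k N) {suc u} (λ {d} → c {d})

coprimesIn-[] : ∀ N u n → (∀ {c} → u < c → c ≤ u + n → ¬ Coprime c N) → coprimesIn N u n ≡ []
coprimesIn-[] N u n none = filter-none (λ k → coprime? k N) (all u n none)
  where
  all : ∀ u n → (∀ {c} → u < c → c ≤ u + n → ¬ Coprime c N) →
        ListAll.All (λ k → ¬ Coprime k N) (interval u n)
  all u zero    _    = ListAll.[]
  all u (suc n) none = none ≤-refl (m<m+n u z<s) ListAll.∷
    all (suc u) n λ u<c c≤ → none (<⇒≤ u<c) (≤-trans c≤ (≤-reflexive (sym (+-suc u n))))

-- For `a` coprime to `N` this is the zero-based position of `a` in `coprimes N`, so the gap that
-- begins at `a` has the one-based index `suc (rank N a)` in the cycle.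
rank : ℕ → ℕ → ℕ
rank N a = length (coprimesIn N 0 (a ∸ 1))

coprimesIn-next : ∀ {N u v} → Next N (suc u) (suc v) →
  coprimesIn N 0 v ≡ coprimesIn N 0 u ++ suc u ∷ []
coprimesIn-next {N} {u} {v} (u<v , c , _ , none) = begin
  coprimesIn N 0 v                                     ≡⟨ cong (coprimesIn N 0) v≡ ⟨
  coprimesIn N 0 (u + suc w)                           ≡⟨ coprimesIn-++ N 0 u (suc w) ⟩
  coprimesIn N 0 u ++ coprimesIn N u (suc w)           ≡⟨ cong (coprimesIn N 0 u ++_) (coprimesIn-∷ N u w (λ {d} → c {d})) ⟩
  coprimesIn N 0 u ++ suc u ∷ coprimesIn N (suc u) w   ≡⟨ cong (λ xs → coprimesIn N 0 u ++ suc u ∷ xs) empty ⟩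
  coprimesIn N 0 u ++ suc u ∷ []                       ∎
  where
  open ≡-Reasoning
  w = v ∸ suc u
  v≡ : u + suc w ≡ v
  v≡ = trans (+-suc u w) (m+[n∸m]≡n (s≤s⁻¹ u<v))
  empty : coprimesIn N (suc u) w ≡ []
  empty = coprimesIn-[] N (suc u) w λ u<c c≤ →
    none u<c (s≤s (≤-trans c≤ (≤-reflexive (trans (sym (+-suc u w)) v≡))))

rank-next : ∀ {N a b} → 1 ≤ a → Next N a b → rank N b ≡ suc (rank N a)
rank-next {N} {suc u} {suc v} _ nx = trans (cong length (coprimesIn-next nx))
  (trans (length-++ (coprimesIn N 0 u)) (+-comm _ 1))

coprimes-from : ∀ {N v} → v ≤ N → Coprime (suc v) N →
  coprimes N ≡ coprimesIn N 0 v ++ suc v ∷ coprimesIn N (suc v) (N ∸ v)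
coprimes-from {N} {v} v≤N c = begin
  coprimes N                                           ≡⟨ cong (filter (λ k → coprime? k N)) (applyUpTo≡interval suc 0 (suc N) λ _ → refl) ⟩
  coprimesIn N 0 (suc N)                               ≡⟨ cong (coprimesIn N 0) 1+N≡ ⟨
  coprimesIn N 0 (v + suc (N ∸ v))                     ≡⟨ coprimesIn-++ N 0 v (suc (N ∸ v)) ⟩
  coprimesIn N 0 v ++ coprimesIn N v (suc (N ∸ v))     ≡⟨ cong (coprimesIn N 0 v ++_) (coprimesIn-∷ N v (N ∸ v) (λ {d} → c {d})) ⟩
  coprimesIn N 0 v ++ suc v ∷ coprimesIn N (suc v) (N ∸ v) ∎
  where
  open ≡-Reasoning
  1+N≡ : v + suc (N ∸ v) ≡ suc N
  1+N≡ = trans (+-suc v _) (cong suc (m+[n∸m]≡n v≤N))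

coprimes-next : ∀ {N a b} → 1 ≤ a → Next N a b → b ≤ suc N →
  ∃[ us ] ∃[ vs ] length us ≡ rank N a × coprimes N ≡ us ++ a ∷ b ∷ vs
coprimes-next {N} {suc u} {suc v} _ nx@(_ , _ , c , _) b≤ = coprimesIn N 0 u , _ , refl , (begin
  coprimes N                                           ≡⟨ coprimes-from (s≤s⁻¹ b≤) (λ {d} → c {d}) ⟩
  coprimesIn N 0 v ++ suc v ∷ vs                       ≡⟨ cong (_++ suc v ∷ vs) (coprimesIn-next nx) ⟩
  (coprimesIn N 0 u ++ suc u ∷ []) ++ suc v ∷ vs       ≡⟨ ++-assoc (coprimesIn N 0 u) _ _ ⟩
  coprimesIn N 0 u ++ suc u ∷ suc v ∷ vs               ∎)
  where
  open ≡-Reasoning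
  vs = coprimesIn N (suc v) (N ∸ v)

-- Reading gaps of the cycle from pairs of consecutive coprimes.

-- Only the length of `ds` is recorded, because only the position of the gap `b ∸ a` matters.
differences-++ : ∀ us a b vs → ∃[ ds ] length ds ≡ length us ×
  differences (us ++ a ∷ b ∷ vs) ≡ ds ++ (b ∸ a) ∷ differences (b ∷ vs)
differences-++ []           a b vs = [] , refl , refl
differences-++ (x ∷ [])     a b vs = (a ∸ x) ∷ [] , refl , refl
differences-++ (x ∷ y ∷ us) a b vs with differences-++ (y ∷ us) a b vs
... | ds , len , eq = (y ∸ x) ∷ ds , cong suc len , cong ((y ∸ x) ∷_) eq

length-differences-∷ : ∀ us (a : ℕ) → length (differences (us ++ a ∷ [])) ≡ length us
length-differences-∷ []           a = refl
length-differences-∷ (x ∷ [])     a = refl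
length-differences-∷ (x ∷ y ∷ us) a = cong suc (length-differences-∷ (y ∷ us) a)

lookup-cast : ∀ (xs : List ℕ) us x vs → xs ≡ us ++ x ∷ vs →
  ∀ {n} .(eq : length xs ≡ n) (i : Fin n) → toℕ i ≡ length us →
  Vec.lookup (Vec.cast eq (Vec.fromList xs)) i ≡ x
lookup-cast (y ∷ xs) []       x vs refl {suc n} eq Fin.zero    _  = refl
lookup-cast (y ∷ xs) (u ∷ us) x vs refl {suc n} eq (Fin.suc i) i≡ =
  lookup-cast xs us x vs refl (suc-injective eq) i (suc-injective i≡)

cyclicGap-next : ∀ m {a b} → 1 ≤ a → Next (Π m) a b → b ≤ suc (Π m) →
  cyclicGap m (suc (rank (Π m) a)) ≡ b ∸ a
cyclicGap-next m {a} {b} 1≤a nx b≤ with coprimes-next 1≤a nx b≤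
... | us , vs , len-us , c≡ with differences-++ us a b vs
...   | ds , len-ds , d≡ = lookup-cast _ ds (b ∸ a) _ d≡′ (length-gaps m) _
    (trans (toℕ-fromℕ< (m%n<n r (Φ m))) (trans (m<n⇒m%n≡m r<Φ) (sym len)))
  where
  instance _ = Φ-nonZero m
  r = rank (Π m) a
  len : length ds ≡ r
  len = trans len-ds len-us
  d≡′ = trans (cong differences c≡) d≡
  r<Φ : r < Φ m
  -- The list of differences has `Φ m` entries and `b ∸ a` comes after the first `r` of them; hence
  -- reduction modulo `Φ m` leaves `r` unchanged.
  r<Φ = subst₂ _<_ len (trans (sym (trans (cong length d≡′) (length-++ ds))) (length-gaps m))
    (m<m+n (length ds) z<s)

-- `suc (Π m)` is the last entry of `coprimes (Π m)`, so its position is the number of gaps.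
rank-end : ∀ m → Coprime (suc (Π m)) (Π m) → rank (Π m) (suc (Π m)) ≡ Φ m
rank-end m c = begin
  length us                                  ≡⟨ length-differences-∷ us (suc N) ⟨
  length (differences (us ++ suc N ∷ []))    ≡⟨ cong (length ∘ differences) split ⟨
  length (differences (coprimes N))          ≡⟨ length-gaps m ⟩
  Φ m                                        ∎
  where
  open ≡-Reasoning
  N = Π m
  us = coprimesIn N 0 N
  split : coprimes N ≡ us ++ suc N ∷ []
  split = trans (coprimes-from ≤-refl (λ {d} → c {d}))
    (cong (λ k → us ++ suc N ∷ coprimesIn N (suc N) k) (n∸n≡0 N))

cyclicGap-wrap : ∀ m → cyclicGap m (suc (Φ m)) ≡ cyclicGap m 1
cyclicGap-wrap m = cong (Vec.lookup (𝒢 m)) (fromℕ<-cong _ _ ([m+n]%n≡m%n 0 (Φ m)) _ _)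
  where instance _ = Φ-nonZero m

-- Constellations given by chains of positions.

-- A constellation is encoded by positions `h 0`, ..., `h j`, so that its sum telescopes.
gaps : (ℕ → ℕ) → ∀ j → Vec ℕ j
gaps h j = Vec.tabulate λ l → h (suc (toℕ l)) ∸ h (toℕ l)

sum-gaps : ∀ h j → (∀ l → l < j → h l < h (suc l)) → h 0 + Vec.sum (gaps h j) ≡ h j
sum-gaps h zero    _    = +-identityʳ (h 0)
sum-gaps h (suc j) mono = begin
  h 0 + ((h 1 ∸ h 0) + s)  ≡⟨ +-assoc (h 0) _ s ⟨
  h 0 + (h 1 ∸ h 0) + s    ≡⟨ cong (_+ s) (m+[n∸m]≡n (<⇒≤ (mono 0 z<s))) ⟩
  h 1 + s                  ≡⟨ sum-gaps (h ∘ suc) j (λ l l<j → mono (suc l) (s<s l<j)) ⟩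
  h (suc j)                ∎
  where
  open ≡-Reasoning
  s = Vec.sum (gaps (h ∘ suc) j)

-- This is `OccursAt` for `gaps h j`, with bounded natural numbers as indices in place of `Fin`.
GapsAt : (ℕ → ℕ) → ℕ → (ℕ → ℕ) → ℕ → Set
GapsAt h j a i = ∀ l → l < j → a (i + l) ≡ h (suc l) ∸ h l

gapsAt⇒occursAt : ∀ h {j} a i → GapsAt h j a i → OccursAt (gaps h j) a i
gapsAt⇒occursAt h a i at l = trans (at (toℕ l) (toℕ<n l)) (sym (lookup∘tabulate _ l))

occursAt⇒gapsAt : ∀ h {j} a i → OccursAt (gaps h j) a i → GapsAt h j a i
occursAt⇒gapsAt h a i at l l<j = subst (λ k → a (i + k) ≡ h (suc k) ∸ h k)
  (toℕ-fromℕ< l<j) (trans (at (fromℕ< l<j)) (lookup∘tabulate _ (fromℕ< l<j)))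

-- The conjecture in terms of positions: by telescoping, the bound on the sum becomes a comparison
-- of `h j` with `h 0`, free of truncated subtraction.
conjecture-gaps : ConstellationConjecture → ∀ {m h j i} → 1 ≤ m → 1 ≤ i →
  (∀ l → l < j → h l < h (suc l)) → GapsAt h j (cyclicGap m) i →
  h j < h 0 + 2 * p (suc m) → j < p (suc m) ∸ 1 → InfinitelyOften (GapsAt h j g)
conjecture-gaps conj {m} {h} {j} {i} 1≤m 1≤i mono at sum< j< N
  with conj m 1≤m (gaps h j) (tabulate⁺ λ l → m<n⇒0<n∸m (mono (toℕ l) (toℕ<n l)))
            (i , 1≤i , gapsAt⇒occursAt h (cyclicGap m) i at)
            (+-cancelˡ-< (h 0) _ _ (subst (_< h 0 + 2 * p (suc m)) (sym (sum-gaps h j mono)) sum<))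
            j< N
... | n , N<n , occ = n , N<n , occursAt⇒gapsAt h g n occ

module _ {N j : ℕ} {h : ℕ → ℕ} (1≤h : 1 ≤ h 0) (next : ∀ l → l < j → Next N (h l) (h (suc l))) where

  chain-≥1 : ∀ l → l ≤ j → 1 ≤ h l
  chain-≥1 zero    _   = 1≤h
  chain-≥1 (suc l) l<j = ≤-<-trans z≤n (proj₁ (next l l<j))

  rank-chain : ∀ l → l ≤ j → rank N (h l) ≡ rank N (h 0) + l
  rank-chain zero    _   = sym (+-identityʳ _)
  rank-chain (suc l) l<j = trans (rank-next (chain-≥1 l (<⇒≤ l<j)) (next l l<j))
    (trans (cong suc (rank-chain l (<⇒≤ l<j))) (sym (+-suc _ l)))

  chain-mono : ∀ l d → l + d ≤ j → h l ≤ h (l + d)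
  chain-mono l zero    _  = ≤-reflexive (cong h (sym (+-identityʳ l)))
  chain-mono l (suc d) le = ≤-trans (chain-mono l d (<⇒≤ le′))
    (subst (λ k → h (l + d) ≤ h k) (sym (+-suc l d)) (<⇒≤ (proj₁ (next (l + d) le′))))
    where le′ = subst (_≤ j) (+-suc l d) le

-- Ranks grow by one along the chain, so its gaps have consecutive indices; `chain-mono` keeps every
-- position inside the first period.
cyclicGap-chain : ∀ {m j h} → 1 ≤ h 0 → (∀ l → l < j → Next (Π m) (h l) (h (suc l))) →
  h j ≤ suc (Π m) → GapsAt h j (cyclicGap m) (suc (rank (Π m) (h 0)))
cyclicGap-chain {m} {j} {h} 1≤h next hj≤ l l<j = trans
  (cong (cyclicGap m ∘ suc) (sym (rank-chain 1≤h next l (<⇒≤ l<j))))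
  (cyclicGap-next m (chain-≥1 1≤h next l (<⇒≤ l<j)) (next l l<j) (≤-trans
    (subst (λ k → h (suc l) ≤ h k) (m+[n∸m]≡n l<j)
      (chain-mono {h = h} 1≤h next (suc l) (j ∸ suc l) (≤-reflexive (m+[n∸m]≡n l<j)))) hj≤))

-- Prime factors and coprimality to `Π m`.

primeFactor : ∀ {n} → 1 < n → ∃[ q ] Prime q × q ∣ n
primeFactor {n@(suc _)} 1<n = go factors factorsPrime isFactorisation
  where
  open PrimeFactorisation (factorise n)
  go : ∀ qs → ListAll.All Prime qs → n ≡ product qs → ∃[ q ] Prime q × q ∣ n
  go []       _                n≡1 = contradiction (sym n≡1) (<⇒≢ 1<n)
  go (q ∷ qs) (pr ListAll.∷ _) n≡  = q , pr , subst (q ∣_) (sym n≡) (m∣m*n (product qs))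

-- Either every entry of the prime factorisation is 2, or some entry is not.
power2⊎oddPrimeFactor : ∀ n .{{_ : NonZero n}} →
  (∃[ e ] n ≡ 2 ^ e) ⊎ (∃[ q ] Prime q × q ≢ 2 × q ∣ n)
power2⊎oddPrimeFactor n with go factors factorsPrime
  where
  open PrimeFactorisation (factorise n)
  go : ∀ qs → ListAll.All Prime qs →
       (∃[ e ] product qs ≡ 2 ^ e) ⊎ (∃[ q ] Prime q × q ≢ 2 × q ∣ product qs)
  go []       _                 = inj₁ (0 , refl)
  go (q ∷ qs) (pr ListAll.∷ ps) with q ≟ 2 | go qs ps
  ... | no q≢2   | _                         = inj₂ (q , pr , q≢2 , m∣m*n (product qs))
  ... | yes refl | inj₁ (e , eq)             = inj₁ (suc e , cong (2 *_) eq)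
  ... | yes refl | inj₂ (r , pr′ , r≢2 , r∣) = inj₂ (r , pr′ , r≢2 , ∣n⇒∣m*n 2 r∣)
... | inj₁ (e , eq)             = inj₁ (e , trans isFactorisation eq)
  where open PrimeFactorisation (factorise n)
... | inj₂ (q , pr , q≢2 , q∣) = inj₂ (q , pr , q≢2 , subst (q ∣_) (sym isFactorisation) q∣)
  where open PrimeFactorisation (factorise n)

noCommonPrime⇒coprime : ∀ {a N} .{{_ : NonZero N}} → (∀ {q} → Prime q → q ∣ a → ¬ q ∣ N) → Coprime a N
noCommonPrime⇒coprime {N = N} f {zero}        (_ , 0∣N) = contradiction (0∣⇒≡0 0∣N) (≢-nonZero⁻¹ N)
noCommonPrime⇒coprime f {suc zero}          _         = refl
noCommonPrime⇒coprime f {d@(suc (suc _))}   (d∣a , d∣N) with primeFactor {d} (s≤s (s≤s z≤n))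
... | q , pr , q∣d = contradiction (∣-trans q∣d d∣N) (f pr (∣-trans q∣d d∣a))

prime⇒1< : ∀ {q} → Prime q → 1 < q
prime⇒1< {q} pr = nonTrivial⇒n>1 q {{prime⇒nonTrivial pr}}

prime∤1 : ∀ {q} → Prime q → ¬ q ∣ 1
prime∤1 pr q∣1 = <⇒≢ (prime⇒1< pr) (sym (∣1⇒≡1 q∣1))

commonPrime⇒¬coprime : ∀ {a N q} → Prime q → q ∣ a → q ∣ N → ¬ Coprime a N
commonPrime⇒¬coprime pr q∣a q∣N c = <⇒≢ (prime⇒1< pr) (sym (c (q∣a , q∣N)))

prime∣prime⇒≡ : ∀ {q r} → Prime q → Prime r → q ∣ r → q ≡ r
prime∣prime⇒≡ pq pr q∣r with prime⇒irreducible pr q∣r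
... | inj₁ refl = contradiction pq ¬prime[1]
... | inj₂ q≡r  = q≡r

i<p : ∀ i → i < p i
i<p zero    = z<s
i<p (suc i) = ≤-<-trans (i<p i) (p-<suc i)

Π-nonZero : ∀ m → NonZero (Π m)
Π-nonZero zero    = _
Π-nonZero (suc m) = m*n≢0 (Π m) (p (suc m)) {{Π-nonZero m}} {{prime⇒nonZero (p-prime m)}}

p≤Π : ∀ m → p m ≤ Π m
p≤Π zero    = ≤-refl
p≤Π (suc m) = m≤n*m (p (suc m)) (Π m) {{Π-nonZero m}}

-- By `p-least` no prime is skipped: a prime below `p (suc (suc m))` is below `p (suc m)` or equal
-- to it, and induction on `m` applies.
prime<⇒∣Π : ∀ m {q} → Prime q → q < p (suc m) → q ∣ Π m
prime<⇒∣Π zero    pr q< = contradiction (p-least 0 pr (prime⇒1< pr)) (<⇒≱ q<)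
prime<⇒∣Π (suc m) {q} pr q< = go (m≤n⇒m<n∨m≡n (≮⇒≥ λ p<q → <⇒≱ q< (p-least (suc m) pr p<q)))
  where
  go : q < p (suc m) ⊎ q ≡ p (suc m) → q ∣ Π (suc m)
  go (inj₁ q<p) = ∣m⇒∣m*n (p (suc m)) (prime<⇒∣Π m pr q<p)
  go (inj₂ q≡p) = subst (_∣ Π (suc m)) (sym q≡p) (n∣m*n (Π m))

prime∣Π⇒≤ : ∀ m {q} → Prime q → q ∣ Π m → q ≤ p m
prime∣Π⇒≤ zero    pr q∣1 = contradiction q∣1 (prime∤1 pr)
prime∣Π⇒≤ (suc m) pr q∣Π with euclidsLemma (Π m) (p (suc m)) pr q∣Π
... | inj₁ q∣Πm = ≤-trans (prime∣Π⇒≤ m pr q∣Πm) (<⇒≤ (p-<suc m))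
... | inj₂ q∣p  = ∣⇒≤ {{prime⇒nonZero (p-prime m)}} q∣p

p∤Π : ∀ m → Coprime (p (suc m)) (Π m)
p∤Π m = noCommonPrime⇒coprime {{Π-nonZero m}} λ pr q∣p q∣Π →
  <⇒≱ (p-<suc m) (subst (_≤ p m) (prime∣prime⇒≡ pr (p-prime m) q∣p) (prime∣Π⇒≤ m pr q∣Π))

¬coprime-Π : ∀ m {c} → 1 < c → c < p (suc m) → ¬ Coprime c (Π m)
¬coprime-Π m {c} 1<c c<p with primeFactor 1<c
... | q , pr , q∣c = commonPrime⇒¬coprime pr q∣c
  (prime<⇒∣Π m pr (≤-<-trans (∣⇒≤ {{>-nonZero (<⇒≤ 1<c)}} q∣c) c<p))

next-1-p : ∀ m → Next (Π m) 1 (p (suc m))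
next-1-p m = prime⇒1< (p-prime m) , 1-coprimeTo (Π m) , (λ {d} → p∤Π m {d}) , ¬coprime-Π m

coprime⇒p≤ : ∀ m {c} → 1 < c → Coprime c (Π m) → p (suc m) ≤ c
coprime⇒p≤ m 1<c c⊥ = ≮⇒≥ λ c<p → ¬coprime-Π m 1<c c<p λ {d} → c⊥ {d}

coprime-suc : ∀ N → Coprime (suc N) N
coprime-suc N {d} (d∣1+N , d∣N) = ∣1⇒≡1 (∣m+n∣m⇒∣n (subst (d ∣_) (+-comm 1 N) d∣1+N) d∣N)

coprime-reflect : ∀ {N a} → a ≤ N → Coprime a N → Coprime (N ∸ a) N
coprime-reflect {N} {a} a≤N c {d} (d∣N∸a , d∣N) =
  c (∣m+n∣m⇒∣n (subst (d ∣_) (sym (m∸n+n≡m a≤N)) d∣N) d∣N∸a , d∣N)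

-- The map sending `a` to `N ∸ a` preserves coprimality to `N` and reverses order; it is an
-- involution up to `N`, which is why `b ≤ N` is assumed.
next-reflect : ∀ {N a b} → b ≤ N → Next N a b → Next N (N ∸ b) (N ∸ a)
next-reflect {N} {a} {b} b≤N (a<b , a⊥ , b⊥ , none) =
  ∸-monoʳ-< a<b b≤N , (λ {d} → coprime-reflect b≤N (λ {e} → b⊥ {e}) {d}) ,
  (λ {d} → coprime-reflect a≤N (λ {e} → a⊥ {e}) {d}) , none′
  where
  a≤N = ≤-trans (<⇒≤ a<b) b≤N
  none′ : ∀ {c} → N ∸ b < c → c < N ∸ a → ¬ Coprime c N
  none′ {c} <c c< c⊥ = none
    (subst (_< N ∸ c) (m∸[m∸n]≡n a≤N) (∸-monoʳ-< c< (m∸n≤m N a)))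
    (subst (N ∸ c <_) (m∸[m∸n]≡n b≤N) (∸-monoʳ-< <c c≤N))
    λ {d} → coprime-reflect c≤N (λ {e} → c⊥ {e}) {d}
    where c≤N = ≤-trans (<⇒≤ c<) (m∸n≤m N a)

-- The only integer strictly in between is `N`, which is not coprime to itself when `1 < N`.
next-∸1-suc : ∀ {N} → 1 < N → Next N (N ∸ 1) (suc N)
next-∸1-suc {N@(suc n)} 1<N = <-trans (n<1+n n) (n<1+n N) ,
  (λ {d} → coprime-reflect {N} {1} (<⇒≤ 1<N) (λ {e} → 1-coprimeTo N {e}) {d}) ,
  (λ {d} → coprime-suc N {d}) ,
  λ n<c c<2+n c⊥ → <⇒≢ 1<N (sym (c⊥ (subst (N ∣_) (≤-antisym n<c (s≤s⁻¹ c<2+n)) ∣-refl , ∣-refl)))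

-- A large gap next to a gap 2, at the end of the cycle.

triple : ℕ → ℕ → ℕ → ℕ → ℕ
triple a b c 0 = a
triple a b c 1 = b
triple a b c _ = c

infinitelyOften-map : ∀ {P Q : ℕ → Set} → (∀ n → P n → Q n) → InfinitelyOften P → InfinitelyOften Q
infinitelyOften-map f inf N = let n , N<n , Pn = inf N in n , N<n , f n Pn

<⇒<∸1 : ∀ {a b} → suc a < b → a < b ∸ 1
<⇒<∸1 (s≤s lt) = lt

m<p[1+m]∸1 : ∀ m → m < p (suc m) ∸ 1
m<p[1+m]∸1 m = <⇒<∸1 (i<p (suc m))

2<Π : ∀ {m} → 2 ≤ m → 2 < Π m
2<Π {m} 2≤m = ≤-<-trans 2≤m (<-≤-trans (i<p m) (p≤Π m))

module _ {m} (2≤m : 2 ≤ m) where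
  private
    N = Π m
    q = p (suc m)

    1≤N : 1 ≤ N
    1≤N = <⇒≤ (<-trans (s<s z<s) (2<Π 2≤m))

    nextΠ : Next N (N ∸ 1) (suc N)
    nextΠ = next-∸1-suc (<-trans (s<s z<s) (2<Π 2≤m))

    1≤N∸1 : 1 ≤ N ∸ 1
    1≤N∸1 = m<n⇒0<n∸m (<-trans (s<s z<s) (2<Π 2≤m))

    -- Euclid's argument: `N ∸ 1` exceeds 1 and is coprime to `N`, and `q` is the least such number.
    -- This keeps `N ∸ q` positive.
    q≤N∸1 : q ≤ N ∸ 1
    q≤N∸1 = coprime⇒p≤ m (∸-monoˡ-< (2<Π 2≤m) (s≤s z≤n)) λ {d} → proj₁ (proj₂ nextΠ) {d}

    q<N : q < N
    q<N = ≤-<-trans q≤N∸1 (∸-monoʳ-< z<s 1≤N)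

    N∸1≡ : N ∸ q + (q ∸ 1) ≡ N ∸ 1
    N∸1≡ = trans (sym (+-∸-assoc (N ∸ q) (<⇒≤ (prime⇒1< (p-prime m)))))
      (cong (_∸ 1) (m∸n+n≡m (<⇒≤ q<N)))

    gapΠ : suc N ∸ (N ∸ 1) ≡ 2
    gapΠ = trans (+-∸-assoc 1 (m∸n≤m N 1)) (cong suc (m∸[m∸n]≡n 1≤N))

    2<q∸1 : 2 < q ∸ 1
    2<q∸1 = ≤-<-trans 2≤m (m<p[1+m]∸1 m)

  module _ (conj : ConstellationConjecture) {t} (t≤m : t ≤ m) where
    private
      t<q∸1 : t < q ∸ 1
      t<q∸1 = ≤-<-trans t≤m (m<p[1+m]∸1 m)

    largeThenSmall : InfinitelyOften λ n → t < g n × g (suc n) ≡ 2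
    largeThenSmall = infinitelyOften-map result (conjecture-gaps conj {m} {h} {2} (<⇒≤ 2≤m) (s≤s z≤n)
        (λ l l<2 → proj₁ (next l l<2)) (cyclicGap-chain {m} {2} {h} (m<n⇒0<n∸m q<N) next ≤-refl) sum< 2<q∸1)
      where
      h = triple (N ∸ q) (N ∸ 1) (suc N)
      next : ∀ l → l < 2 → Next N (h l) (h (suc l))
      -- The mirror image of the pair `1`, `q`.
      next 0 _ = next-reflect (<⇒≤ q<N) (next-1-p m)
      next 1 _ = nextΠ
      next (suc (suc _)) (s≤s (s≤s ()))
      -- The sum of the two gaps is `q + 1`, less than `2 * q` because `1 < q`.
      sum< : suc N < N ∸ q + 2 * q
      sum< = subst (suc N <_) (trans (cong (_+ q) (sym (m∸n+n≡m (<⇒≤ q<N))))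
          (trans (+-assoc (N ∸ q) q q) (cong (λ t → N ∸ q + (q + t)) (sym (+-identityʳ q)))))
        (subst (_< N + q) (+-comm N 1) (+-monoʳ-< N (prime⇒1< (p-prime m))))
      result : ∀ n → GapsAt h 2 g n → t < g n × g (suc n) ≡ 2
      result n at =
        subst (t <_) (sym (trans (trans (cong g (sym (+-identityʳ n))) (at 0 z<s))
          (trans (cong (_∸ (N ∸ q)) (sym N∸1≡)) (m+n∸m≡n (N ∸ q) (q ∸ 1))))) t<q∸1 ,
        trans (trans (cong g (+-comm 1 n)) (at 1 (s<s z<s))) gapΠ

    -- Here the positions run past `suc N`, so `cyclicGap-chain` does not apply: the second gap is
    -- read after wrapping around to the start of the cycle.
    smallThenLarge : InfinitelyOften λ n → g n ≡ 2 × t < g (suc n)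
    smallThenLarge = infinitelyOften-map result
        (conjecture-gaps conj {m} {h} {2} {suc r} (<⇒≤ 2≤m) (s≤s z≤n) mono at sum< 2<q∸1)
      where
      h = triple (N ∸ 1) (suc N) (N + q)
      r = rank N (N ∸ 1)
      mono : ∀ l → l < 2 → h l < h (suc l)
      mono 0 _ = proj₁ nextΠ
      mono 1 _ = subst (_< N + q) (+-comm N 1) (+-monoʳ-< N (prime⇒1< (p-prime m)))
      mono (suc (suc _)) (s≤s (s≤s ()))
      -- The gap across `N` is the last one of the period.
      r≡ : suc r ≡ Φ m
      r≡ = trans (sym (rank-next 1≤N∸1 nextΠ)) (rank-end m λ {d} → coprime-suc N {d})
      at : GapsAt h 2 (cyclicGap m) (suc r)
      at 0 _ = trans (cong (cyclicGap m ∘ suc) (+-identityʳ r)) (cyclicGap-next m 1≤N∸1 nextΠ ≤-refl)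
      at 1 _ = begin
        cyclicGap m (suc r + 1)   ≡⟨ cong (cyclicGap m) (trans (+-comm (suc r) 1) (cong suc r≡)) ⟩
        cyclicGap m (suc (Φ m))   ≡⟨ cyclicGap-wrap m ⟩
        -- `rank N 1` computes to 0, so index 1 is the gap from `1` to `q`.
        cyclicGap m 1             ≡⟨ cyclicGap-next m ≤-refl (next-1-p m) (<⇒≤ (<-trans q<N ≤-refl)) ⟩
        q ∸ 1                     ≡⟨ [m+n]∸[m+o]≡n∸o N q 1 ⟨
        (N + q) ∸ (N + 1)         ≡⟨ cong (N + q ∸_) (+-comm N 1) ⟩
        (N + q) ∸ suc N           ∎
        where open ≡-Reasoning
      at (suc (suc _)) (s≤s (s≤s ()))
      sum< : N + q < N ∸ 1 + 2 * q
      sum< = begin-strict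
        N + q               ≡⟨ cong (_+ q) (m∸n+n≡m 1≤N) ⟨
        N ∸ 1 + 1 + q       ≡⟨ +-assoc (N ∸ 1) 1 q ⟩
        N ∸ 1 + (1 + q)     <⟨ +-monoʳ-< (N ∸ 1) (+-monoˡ-< q (prime⇒1< (p-prime m))) ⟩
        N ∸ 1 + (q + q)     ≡⟨ cong (λ t → N ∸ 1 + (q + t)) (+-identityʳ q) ⟨
        N ∸ 1 + 2 * q       ∎
        where open ≤-Reasoning
      result : ∀ n → GapsAt h 2 g n → g n ≡ 2 × t < g (suc n)
      result n at =
        trans (trans (cong g (sym (+-identityʳ n))) (at 0 z<s)) gapΠ ,
        subst (t <_) (sym (trans (cong g (+-comm 1 n)) (trans (at 1 (s<s z<s))
          (trans (cong (N + q ∸_) (+-comm 1 N)) ([m+n]∸[m+o]≡n∸o N q 1))))) t<q∸1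

-- Limits of the gap ratios.

-- Since its denominator is at least 1, `K` is at most the absolute value of its numerator. Passing
-- to unnormalised rationals reduces the claim to cross multiplication, without the gcd in `ℚ./`.
<-/ : ∀ K a d .{{_ : NonZero d}} → d * suc ℤ.∣ ℚ.↥ K ∣ ≤ a → K ℚ.< (ℤ.+ a) ℚ./ d
<-/ K@(mkℚ n e _) a (suc d) le = ℚ.toℚᵘ-cancel-<
  (ℚᵘ.<-respʳ-≃ (ℚᵘ.≃-sym (ℚ.toℚᵘ-fromℚᵘ (mkℚᵘ (ℤ.+ a) d))) (ℚᵘ.*<* (cross n le)))
  where
  cross : ∀ n → suc d * suc ℤ.∣ n ∣ ≤ a → n ℤ.* ℤ.+ suc d ℤ.< ℤ.+ a ℤ.* ℤ.+ suc e
  cross (ℤ.+ n) le = subst₂ ℤ._<_ (ℤ.pos-* n (suc d)) (ℤ.pos-* a (suc e)) (ℤ.+<+ (begin-strict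
    n * suc d       ≡⟨ *-comm n (suc d) ⟩
    suc d * n       <⟨ *-monoʳ-< (suc d) (n<1+n n) ⟩
    suc d * suc n   ≤⟨ le ⟩
    a               ≤⟨ m≤m*n a (suc e) ⟩
    a * suc e       ∎))
    where open ≤-Reasoning
  cross ℤ.-[1+ n ] le = subst (ℤ.-[1+ n ] ℤ.* ℤ.+ suc d ℤ.<_) (ℤ.pos-* a (suc e)) ℤ.-<+

-- A positive `ε` has numerator at least 1, so it is at least the reciprocal of its denominator.
/-< : ∀ {ε} → 0ℚ ℚ.< ε → ∀ a d .{{_ : NonZero d}} → a * ℚ.↧ₙ ε < d → (ℤ.+ a) ℚ./ d ℚ.< ε
/-< {ε@(mkℚ n e _)} 0<ε a (suc d) lt = ℚ.toℚᵘ-cancel-<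
  (ℚᵘ.<-respˡ-≃ (ℚᵘ.≃-sym (ℚ.toℚᵘ-fromℚᵘ (mkℚᵘ (ℤ.+ a) d))) (ℚᵘ.*<* (cross n (ℚ.positive 0<ε))))
  where
  cross : ∀ n → ℤ.Positive n → ℤ.+ a ℤ.* ℤ.+ suc e ℤ.< n ℤ.* ℤ.+ suc d
  cross (ℤ.+ suc n) _ = subst₂ ℤ._<_ (ℤ.pos-* a (suc e)) (ℤ.pos-* (suc n) (suc d))
    (ℤ.+<+ (<-≤-trans lt (m≤n*m (suc d) (suc n))))

spikes : ConstellationConjecture → Limsup≡∞ gapRatio × Liminf≡ gapRatio 0ℚ
-- Ratios are nonnegative, hence above `0ℚ ℚ.- ε` from the start: the threshold is 0.
spikes conj = limsup , λ ε 0<ε → (0 , λ n _ → lower ε 0<ε n) , upper ε 0<ε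
  where
  limsup : Limsup≡∞ gapRatio
  limsup K = infinitelyOften-map
    (λ n (large , small) → <-/ K (g n) (g (suc n)) {{g-nonZero (suc n)}}
      (subst (λ d → d * suc ℤ.∣ ℚ.↥ K ∣ ≤ g n) (sym small) (<⇒≤ large)))
    -- Here `m` is `2 + t`, which gives both `2 ≤ m` and `t ≤ m`; the factor 2 in `t` is the small
    -- gap in the denominator of the ratio.
    (largeThenSmall (m≤m+n 2 _) conj (m≤n+m (2 * suc ℤ.∣ ℚ.↥ K ∣) 2))
  lower : ∀ ε → 0ℚ ℚ.< ε → ∀ n → 0ℚ ℚ.- ε ℚ.< gapRatio n
  lower ε 0<ε n = ℚ.<-≤-trans (subst (ℚ._< 0ℚ) (sym (ℚ.+-identityˡ (ℚ.- ε))) (ℚ.neg-antimono-< 0<ε))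
    (ℚ.nonNegative⁻¹ (gapRatio n) {{ℚ.normalize-nonNeg (g n) (g (suc n)) {{g-nonZero (suc n)}}}})
  upper : ∀ ε → 0ℚ ℚ.< ε → InfinitelyOften λ n → gapRatio n ℚ.< 0ℚ ℚ.+ ε
  upper ε 0<ε = infinitelyOften-map
    (λ n (small , large) → subst (gapRatio n ℚ.<_) (sym (ℚ.+-identityˡ ε))
      (/-< 0<ε (g n) (g (suc n)) {{g-nonZero (suc n)}}
        (subst (λ a → a * ℚ.↧ₙ ε < g (suc n)) (sym small) large)))
    (smallThenLarge (m≤m+n 2 _) conj (m≤n+m (2 * ℚ.↧ₙ ε) 2))

-- Gaps 2, 4, 8, ... at the middle of the cycle.

-- Π-odd m belongs to Π (suc m): it is the product of p 2, …, p (m + 1).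

Π-odd : ℕ → ℕ
Π-odd zero    = 1
Π-odd (suc m) = Π-odd m * p (suc (suc m))

p₁≡2 : p 1 ≡ 2
p₁≡2 = ≤-antisym (p-least 0 prime[2] (s<s z<s)) (prime⇒1< (p-prime 0))

Π≡2*Π-odd : ∀ m → Π (suc m) ≡ 2 * Π-odd m
Π≡2*Π-odd zero    = trans (*-identityˡ (p 1)) p₁≡2
Π≡2*Π-odd (suc m) = trans (cong (_* p (suc (suc m))) (Π≡2*Π-odd m)) (*-assoc 2 (Π-odd m) _)

2<p : ∀ m → 2 < p (suc (suc m))
2<p m = ≤-trans (s≤s (s≤s (s≤s z≤n))) (i<p (suc (suc m)))

2∤Π-odd : ∀ m → ¬ 2 ∣ Π-odd m
2∤Π-odd zero    = prime∤1 prime[2]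
2∤Π-odd (suc m) 2∣ = [ 2∤Π-odd m , <⇒≢ (2<p m) ∘ prime∣prime⇒≡ prime[2] (p-prime (suc m)) ]′
  (euclidsLemma (Π-odd m) (p (suc (suc m))) prime[2] 2∣)

m≤Π-odd : ∀ m → m ≤ Π-odd m
m≤Π-odd zero    = z≤n
m≤Π-odd (suc m) = ≤-trans (<⇒≤ (<-trans (n<1+n (suc m)) (i<p (suc (suc m)))))
  -- `Π-odd m` is nonzero because 0 would be even.
  (m≤n*m (p (suc (suc m))) (Π-odd m) {{≢-nonZero λ eq → 2∤Π-odd m (subst (2 ∣_) (sym eq) (2 ∣0))}})

2∣n⊎2∣1+n : ∀ n → 2 ∣ n ⊎ 2 ∣ suc n
2∣n⊎2∣1+n zero    = inj₁ (2 ∣0)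
2∣n⊎2∣1+n (suc n) = [ (λ 2∣n → inj₂ (∣m∣n⇒∣m+n ∣-refl 2∣n)) , inj₁ ]′ (2∣n⊎2∣1+n n)

odd+odd : ∀ {a b} → ¬ 2 ∣ a → ¬ 2 ∣ b → 2 ∣ a + b
odd+odd {a} {b} 2∤a 2∤b with 2∣n⊎2∣1+n a | 2∣n⊎2∣1+n b
... | inj₁ 2∣a  | _         = contradiction 2∣a 2∤a
... | inj₂ _    | inj₁ 2∣b  = contradiction 2∣b 2∤b
... | inj₂ 2∣1+a | inj₂ 2∣1+b = ∣m+n∣m⇒∣n {2} {2}
  (subst (2 ∣_) (cong suc (+-suc a b)) (∣m∣n⇒∣m+n 2∣1+a 2∣1+b)) ∣-refl

prime∣2^⇒≡2 : ∀ {q} e → Prime q → q ∣ 2 ^ e → q ≡ 2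
prime∣2^⇒≡2 zero    pr q∣1 = contradiction q∣1 (prime∤1 pr)
prime∣2^⇒≡2 (suc e) pr q∣  =
  [ prime∣prime⇒≡ pr prime[2] , prime∣2^⇒≡2 e pr ]′ (euclidsLemma 2 (2 ^ e) pr q∣)

-- If `t` were `2 ^ f`, monotonicity of powers would force `f` strictly between `e` and `suc e`.
between-powers : ∀ {e t} → 2 ^ e < t → t < 2 ^ suc e → ∃[ q ] Prime q × q ≢ 2 × q ∣ t
between-powers {e} {t} e< <e with power2⊎oddPrimeFactor t {{>-nonZero (≤-<-trans z≤n e<)}}
... | inj₂ odd       = odd
... | inj₁ (f , refl) = contradiction
  (≮⇒≥ λ e<f → <⇒≱ <e (^-monoʳ-≤ 2 {suc e} {f} e<f)) (<⇒≱ (≰⇒> λ f≤e → <⇒≱ e< (^-monoʳ-≤ 2 {f} {e} f≤e)))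

module _ (m : ℕ) where
  private
    x = Π-odd m
    N = Π (suc m)

    2∣N : 2 ∣ N
    2∣N = subst (2 ∣_) (sym (Π≡2*Π-odd m)) (m∣m*n x)

    oddPrime∣N⇒∣x : ∀ {q} → Prime q → q ≢ 2 → q ∣ N → q ∣ x
    oddPrime∣N⇒∣x {q} pr q≢2 q∣N =
      [ (λ q∣2 → contradiction (prime∣prime⇒≡ pr prime[2] q∣2) q≢2) , (λ q∣x → q∣x) ]′
        (euclidsLemma 2 x pr (subst (q ∣_) (Π≡2*Π-odd m) q∣N))

  -- The prime 2 divides the power but not `x`; an odd prime dividing `N` divides `x`, so it would
  -- have to divide the power. The exponent starts at 1 because `x + 1` is even.
  coprime-Π-odd+2^ : ∀ e → Coprime (x + 2 ^ suc e) N
  coprime-Π-odd+2^ e = noCommonPrime⇒coprime {{Π-nonZero (suc m)}} λ {q} pr q∣ q∣N → go pr q∣ q∣N (q ≟ 2)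
    where
    go : ∀ {q} → Prime q → q ∣ x + 2 ^ suc e → q ∣ N → Dec (q ≡ 2) → ⊥
    go pr q∣ q∣N (yes refl) = 2∤Π-odd m
      (∣m+n∣m⇒∣n (subst (2 ∣_) (+-comm x (2 ^ suc e)) q∣) (m∣m*n (2 ^ e)))
    go pr q∣ q∣N (no q≢2)   = q≢2
      (prime∣2^⇒≡2 (suc e) pr (∣m+n∣m⇒∣n q∣ (oddPrime∣N⇒∣x pr q≢2 q∣N)))

  -- For odd `t` both `x + t` and `N` are even. For even `t`, an odd prime factor of `t` is below
  -- `p (suc (suc m))`, so it divides `N`, hence `x` and `x + t`.
  ¬coprime-Π-odd+ : ∀ {e t} → 2 ^ suc e ≤ p (suc (suc m)) → 2 ^ e < t → t < 2 ^ suc e → ¬ Coprime (x + t) N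
  ¬coprime-Π-odd+ {e} {t} ≤p e< <e = go (2 ∣? t)
    where
    q∣N : ∀ {q} → Prime q → q ∣ t → q ∣ N
    q∣N pr q∣t = prime<⇒∣Π (suc m) pr
      (<-≤-trans (≤-<-trans (∣⇒≤ {{>-nonZero (≤-<-trans z≤n e<)}} q∣t) <e) ≤p)
    go : Dec (2 ∣ t) → ¬ Coprime (x + t) N
    go (no 2∤t) = commonPrime⇒¬coprime prime[2] (odd+odd (2∤Π-odd m) 2∤t) 2∣N
    go (yes _) = let q , pr , q≢2 , q∣t = between-powers {e} e< <e in
      commonPrime⇒¬coprime pr (∣m∣n⇒∣m+n (oddPrime∣N⇒∣x pr q≢2 (q∣N pr q∣t)) q∣t) (q∣N pr q∣t)

  next-Π-odd+2^ : ∀ e → 2 ^ suc (suc e) ≤ p (suc (suc m)) →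
    Next N (x + 2 ^ suc e) (x + 2 ^ suc (suc e))
  next-Π-odd+2^ e ≤p = +-monoʳ-< x (^-monoʳ-< 2 ≤-refl (n<1+n (suc e))) ,
    (λ {d} → coprime-Π-odd+2^ e {d}) , (λ {d} → coprime-Π-odd+2^ (suc e) {d}) , none
    where
    none : ∀ {c} → x + 2 ^ suc e < c → c < x + 2 ^ suc (suc e) → ¬ Coprime c N
    none {c} <c c< = subst (λ k → ¬ Coprime k N) c≡
      (¬coprime-Π-odd+ {suc e} {c ∸ x} ≤p
        (+-cancelˡ-< x _ _ (subst (x + 2 ^ suc e <_) (sym c≡) <c))
        (+-cancelˡ-< x _ _ (subst (_< x + 2 ^ suc (suc e)) (sym c≡) c<)))
      where
      c≡ : x + (c ∸ x) ≡ c
      c≡ = m+[n∸m]≡n (≤-trans (m≤m+n x (2 ^ suc e)) (<⇒≤ <c))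

-- In the bound on `m`, the power puts `2 ^ suc k` below both the next prime and `x`, and the
-- summand `k` limits the number of gaps.
powerGaps : ConstellationConjecture → ∀ k m → 2 ^ suc k + k ≤ m →
  InfinitelyOften λ j → ∀ i → i < k → g (j + i) ≡ 2 ^ suc i
powerGaps conj k m bound = infinitelyOften-map result (conjecture-gaps conj {suc m} {h} {k} (s≤s z≤n) (s≤s z≤n)
    (λ l l<k → proj₁ (next l l<k))
    (cyclicGap-chain {suc m} {k} {h} (≤-trans (s≤s z≤n) (m≤n+m 2 x)) next end≤) sum< k<)
  where
  x = Π-odd m
  h : ℕ → ℕ
  h l = x + 2 ^ suc l
  2^≤m : 2 ^ suc k ≤ m
  2^≤m = ≤-trans (m≤m+n _ k) bound
  2^≤p : 2 ^ suc k ≤ p (suc (suc m))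
  2^≤p = ≤-trans 2^≤m (<⇒≤ (<-trans (n<1+n m) (<-trans (n<1+n (suc m)) (i<p (suc (suc m))))))
  next : ∀ l → l < k → Next (Π (suc m)) (h l) (h (suc l))
  next l l<k = next-Π-odd+2^ m l (≤-trans (^-monoʳ-≤ 2 (s≤s l<k)) 2^≤p)
  -- The run starts at half of the period `2 * x` and has to end within it.
  end≤ : h k ≤ suc (Π (suc m))
  end≤ = begin
    x + 2 ^ suc k    ≤⟨ +-monoʳ-≤ x (≤-trans 2^≤m (m≤Π-odd m)) ⟩
    x + x            ≡⟨ cong (x +_) (+-identityʳ x) ⟨
    2 * x            ≡⟨ Π≡2*Π-odd m ⟨
    Π (suc m)        ≤⟨ n≤1+n _ ⟩
    suc (Π (suc m))  ∎
    where open ≤-Reasoning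
  sum< : h k < h 0 + 2 * p (suc (suc m))
  sum< = +-mono-<-≤ (m<m+n x z<s) (≤-trans 2^≤p (m≤n*m _ 2))
  k< : k < p (suc (suc m)) ∸ 1
  k< = ≤-<-trans (≤-trans (m≤n+m k (2 ^ suc k)) bound) (<-trans (n<1+n m) (m<p[1+m]∸1 (suc m)))
  result : ∀ j → GapsAt h k g j → ∀ i → i < k → g (j + i) ≡ 2 ^ suc i
  result j at i i<k = trans (at i i<k)
    -- `2 ^ suc (suc i)` unfolds to `2 ^ suc i + (2 ^ suc i + 0)`.
    (trans ([m+n]∸[m+o]≡n∸o x (2 ^ suc (suc i)) (2 ^ suc i))
      (trans (m+n∸m≡n (2 ^ suc i) _) (+-identityʳ (2 ^ suc i))))

superlinearity : ConstellationConjecture → ∀ k →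
  InfinitelyOften λ j → ∀ i → i < k → g (j + i) < g (j + suc i)
superlinearity conj k = infinitelyOften-map
  (λ j at i i<k → subst₂ _<_
    (sym (at i (<-trans i<k (n<1+n k)))) (sym (at (suc i) (s<s i<k)))
    (^-monoʳ-< 2 ≤-refl (n<1+n (suc i))))
  -- A chain of `k` inequalities compares `k + 1` gaps.
  (powerGaps conj (suc k) _ ≤-refl)

-- Two successive increases rule out oscillation.

-- Oscillation makes `g` drop after every index `n₀ + 2 * k` with `1 ≤ k`. One of `j` and `j + 1` is
-- such an index when `n₀ < j`, yet `g` rises after both.
noOscillation : (∀ k → InfinitelyOften λ j → ∀ i → i < k → g (j + i) < g (j + suc i)) →
  ¬ (∃[ n₀ ] ∀ k → 1 ≤ k → g (n₀ + 2 * k ∸ 1) < g (n₀ + 2 * k) × g (n₀ + 2 * k) > g (n₀ + 2 * k + 1))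
noOscillation super (n₀ , osc) = let j , n₀<j , inc = super 2 n₀ in contra j n₀<j inc
  where
  peak : ∀ n c → 1 ≤ n → 2 ∣ n → n₀ + n ≡ c → g (c + 1) < g c
  peak n c 1≤n (divides k n≡) c≡ = subst (λ t → g (t + 1) < g t)
    (trans (cong (n₀ +_) (trans (*-comm 2 k) (sym n≡))) c≡)
    -- `k` is nonzero because the even number `n` is.
    (proj₂ (osc k (>-nonZero⁻¹ k {{m*n≢0⇒m≢0 k {2} {{subst NonZero n≡ (>-nonZero 1≤n)}}}})))
  contra : ∀ j → n₀ < j → (∀ i → i < 2 → g (j + i) < g (j + suc i)) → ⊥
  contra j n₀<j inc = [ even , odd ]′ (2∣n⊎2∣1+n (j ∸ n₀))
    where
    j≡ : n₀ + (j ∸ n₀) ≡ j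
    j≡ = m+[n∸m]≡n (<⇒≤ n₀<j)
    even : 2 ∣ j ∸ n₀ → ⊥
    even 2∣ = <-asym (subst (λ t → g t < g (j + 1)) (+-identityʳ j) (inc 0 z<s))
      (peak (j ∸ n₀) j (m<n⇒0<n∸m n₀<j) 2∣ j≡)
    odd : 2 ∣ suc (j ∸ n₀) → ⊥
    odd 2∣ = <-asym (inc 1 (s<s z<s)) (subst (λ t → g t < g (j + 1)) (+-assoc j 1 1)
      (peak (suc (j ∸ n₀)) (j + 1) (s≤s z≤n) 2∣
        (trans (+-suc n₀ _) (trans (cong suc j≡) (+-comm 1 j)))))

mainTheorem4 : ConstellationConjecture →
    (Limsup≡∞ gapRatio × Liminf≡ gapRatio 0ℚ)
    × (¬ (∃[ n₀ ] ∀ k → 1 ≤ k → g (n₀ + 2 * k ∸ 1) < g (n₀ + 2 * k) × g (n₀ + 2 * k) > g (n₀ + 2 * k + 1)))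
    × (∀ k → 1 ≤ k → InfinitelyOften (λ j → ∀ i → i < k → g (j + i) < g (j + suc i)))
mainTheorem4 conj = spikes conj , noOscillation (superlinearity conj) , λ k _ → superlinearity conj k
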